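{- For any integer $n \geq 0$ (with $a$ denoting a nonnegative integer), $$v_2(B_n(3,0)) = \begin{cases} 0, & \text{if } n \equiv 0 \pmod{4}, \\ 1, & \text{if } n \equiv 5 \pmod{8}, \\ 3, & \text{if } n \equiv 9 \pmod{16}, \\ 1+ v_2 \big( a(a+1) \big), & \text{if } n = 4a + 2 \text{ and } v_2 \big( a(a+1) \big) \leq 4, \\ 0, & \text{if } n \equiv 3 \pmod{4}. \end{cases}$$ (No assertion is made for values of $n$ not covered by these cases.)
   Context: The sequence $\{B_n(3,0)\}_{n\geq 0}$ is defined by $B_n = B_{n-1}+B_{n-2}+B_{n-3}$ for $n \geq 3$, with $(B_0,B_1,B_2)=(1,0,0)$. $v_2$ denotes the 2-adic order (2-adic valuation), with the convention $v_2(0)=+\infty$. -}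

module Defs where

open import Data.Nat.Base using (ℕ; zero; suc; _+_; _^_; _≤_; _<_; z≤n; s≤s)
open import Data.Nat.Divisibility
  using (_∣_; _∤_; _∣?_; _∣0; 1∣_; ∣⇒≤; ∣-trans; m∣m*n)
open import Data.Nat.Properties
  using (≤-trans; ≤-pred; <-cmp; <-irrefl; <⇒≤; <⇒≱; m≤n⇒m<n∨m≡n; +-mono-≤;
         +-identityʳ; m+[n∸m]≡n; m^n>0; ^-distribˡ-+-*)
open import Data.Product.Base using (_×_; _,_)
open import Data.Sum.Base using (inj₁; inj₂)
open import Relation.Binary.Definitions using (tri<; tri≈; tri>)
open import Relation.Binary.PropositionalEquality
  using (_≡_; refl; sym; subst)
open import Relation.Nullary using (yes; no; contradiction)
open import Relation.Nullary.Construct.Add.Supremum using (_⁺; ⊤⁺; [_])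
import Relation.Binary.Construct.Add.Supremum.NonStrict as NonStrict

B : ℕ → ℕ
B 0 = 1
B 1 = 0
B 2 = 0
B (suc (suc (suc n))) = B (suc (suc n)) + B (suc n) + B n

ℕ∞ : Set
ℕ∞ = ℕ ⁺

open NonStrict _≤_ public using () renaming (_≤⁺_ to _≤∞_)

infixl 6 _+∞_

_+∞_ : ℕ∞ → ℕ∞ → ℕ∞
[ m ] +∞ [ n ] = [ m + n ]
[ m ] +∞ ⊤⁺    = ⊤⁺
⊤⁺    +∞ y     = ⊤⁺

-- The largest k ≤ b such that 2 ^ k ∣ m.
maxExponent : (b m : ℕ) → ℕ
maxExponent zero    m = 0
maxExponent (suc b) m with 2 ^ suc b ∣? m
... | yes _ = suc b
... | no  _ = maxExponent b m

-- For m > 0, 2 ^ k ∣ m forces k < 2 ^ k ≤ m, so bounding the exponent by m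
-- loses nothing; see v₂-spec and v₂-unique.
v₂ : ℕ → ℕ∞
v₂ zero      = ⊤⁺
v₂ m@(suc _) = [ maxExponent m m ]

private
  n<2^n : ∀ n → n < 2 ^ n
  n<2^n zero    = s≤s z≤n
  n<2^n (suc n) = subst (λ x → suc (suc n) ≤ 2 ^ n + x) (sym (+-identityʳ (2 ^ n)))
                    (+-mono-≤ (m^n>0 2 n) (n<2^n n))

  2^-mono-∣ : ∀ {i j} → i ≤ j → 2 ^ i ∣ 2 ^ j
  2^-mono-∣ {i} i≤j = subst (λ l → 2 ^ i ∣ 2 ^ l) (m+[n∸m]≡n i≤j)
    (subst (2 ^ i ∣_) (sym (^-distribˡ-+-* 2 i _)) (m∣m*n _))

  maxExponent-∣ : ∀ b m → 2 ^ maxExponent b m ∣ m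
  maxExponent-∣ zero    m = 1∣ m
  maxExponent-∣ (suc b) m with 2 ^ suc b ∣? m
  ... | yes p = p
  ... | no  _ = maxExponent-∣ b m

  maxExponent-max : ∀ b m {k} → k ≤ b → 2 ^ k ∣ m → k ≤ maxExponent b m
  maxExponent-max zero    m k≤b _ = k≤b
  maxExponent-max (suc b) m k≤b d with 2 ^ suc b ∣? m
  ... | yes _ = k≤b
  ... | no ¬p with m≤n⇒m<n∨m≡n k≤b
  ...   | inj₁ k<1+b = maxExponent-max b m (≤-pred k<1+b) d
  ...   | inj₂ refl  = contradiction d ¬p

v₂-spec : ∀ {m k} → v₂ m ≡ [ k ] → 2 ^ k ∣ m × 2 ^ suc k ∤ m
v₂-spec {m@(suc _)} refl = maxExponent-∣ m m , λ d →
  <-irrefl refl (maxExponent-max m m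
    (≤-trans (<⇒≤ (n<2^n _)) (∣⇒≤ d)) d)

v₂-unique : ∀ {m k} → 2 ^ k ∣ m → 2 ^ suc k ∤ m → v₂ m ≡ [ k ]
v₂-unique {zero}      _ n = contradiction (_ ∣0) n
v₂-unique {m@(suc _)} {k} d n with <-cmp k (maxExponent m m)
... | tri< k<e _ _  = contradiction (∣-trans (2^-mono-∣ k<e) (maxExponent-∣ m m)) n
... | tri≈ _ refl _ = refl
... | tri> _ _ e<k  = contradiction
  (maxExponent-max m m (≤-trans (<⇒≤ (n<2^n k)) (∣⇒≤ d)) d) (<⇒≱ e<k)

{-# OPTIONS --safe #-}

-- The sequence B is purely periodic modulo 2⁶ with period 2⁷.  Each valuation
-- claimed is at most 5, hence decided by B n modulo 2⁶; likewise v₂ (a (a + 1)) ≤ 4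
-- is decided by a modulo 2⁵, and then 4 a + 2 is determined modulo 2⁷.  So the
-- theorem reduces to a check over one period.
module Submission where

open import Defs
open import Data.Nat.Base
  using (ℕ; zero; suc; _+_; _*_; _^_; _%_; _/_; _≤_; _<_; z≤n; s≤s; NonZero)
open import Data.Nat.DivMod
  using (m≡m%n+[m/n]*n; m%n<n; m%n%n≡m%n; m∣n⇒o%n%m≡o%m; %-distribˡ-+)
open import Data.Nat.Divisibility
  using (_∣_; _∤_; _∣?_; ∣-trans; n∣m*n; ∣m∣n⇒∣m+n; ∣m+n∣m⇒∣n)
open import Data.Nat.GeneralisedArithmetic using (fold; fold-+)
open import Data.Nat.Properties using (_≟_; +-comm; allUpTo?)
open import Data.Nat.Tactic.RingSolver using (solve-∀)
open import Data.Product.Base using (_×_; _,_; proj₁)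
open import Relation.Binary.PropositionalEquality
  using (_≡_; refl; sym; trans; cong; cong₂; subst; module ≡-Reasoning)
open import Relation.Binary.Construct.Add.Supremum.NonStrict _≤_
  using ([≤]-injective)
open import Relation.Nullary.Construct.Add.Supremum using ([_])
open import Relation.Nullary.Decidable
  using (Dec; ¬?; _×-dec_; _→-dec_; from-yes)

infix 4 _^∥_ _^∥?_

_^∥_ : ℕ → ℕ → Set
k ^∥ m = 2 ^ k ∣ m × 2 ^ suc k ∤ m

_^∥?_ : ∀ k m → Dec (k ^∥ m)
k ^∥? m = (2 ^ k ∣? m) ×-dec ¬? (2 ^ suc k ∣? m)

^∥⇒v₂ : ∀ {k m} → k ^∥ m → v₂ m ≡ [ k ]
^∥⇒v₂ (d , ¬d) = v₂-unique d ¬d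

2^k∣2^[1+k] : ∀ k → 2 ^ k ∣ 2 ^ suc k
2^k∣2^[1+k] k = n∣m*n 2

-- A multiple of `2 ^ suc k` is also one of `2 ^ k`, so adding it changes neither divisibility:
-- `k ^∥ m` depends only on `m` modulo `2 ^ suc k`.
^∥-+ : ∀ k {m d} → 2 ^ suc k ∣ d → k ^∥ m → k ^∥ m + d
^∥-+ k {m} {d} p∣d (q∣m , p∤m) =
    ∣m∣n⇒∣m+n q∣m (∣-trans (2^k∣2^[1+k] k) p∣d)
  , λ p∣m+d → p∤m (∣m+n∣m⇒∣n (subst (2 ^ suc k ∣_) (+-comm m d) p∣m+d) p∣d)

^∥-+⁻ : ∀ k {m d} → 2 ^ suc k ∣ d → k ^∥ m + d → k ^∥ m
^∥-+⁻ k {m} {d} p∣d (q∣m+d , p∤m+d) =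
    ∣m+n∣m⇒∣n (subst (2 ^ k ∣_) (+-comm m d) q∣m+d) (∣-trans (2^k∣2^[1+k] k) p∣d)
  , λ p∣m → p∤m+d (∣m∣n⇒∣m+n p∣m p∣d)

State : Set
State = ℕ × ℕ × ℕ

-- Reducing at every step keeps all entries below 64, so that a whole period can be evaluated.
step : State → State
step (x , y , z) = y , z , (z + y + x) % 64

state : ℕ → State
state = fold (1 , 0 , 0) step

residue : ℕ → ℕ
residue n = proj₁ (state n)

%-distribˡ-+₃ : ∀ x y z d .{{_ : NonZero d}} →
                (x % d + y % d + z % d) % d ≡ (x + y + z) % d
%-distribˡ-+₃ x y z d = begin
  (x % d + y % d + z % d) % d                ≡⟨ %-distribˡ-+ (x % d + y % d) (z % d) d ⟩
  ((x % d + y % d) % d + z % d % d) % d      ≡⟨ cong₂ (λ s t → (s + t) % d)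
                                                  (sym (%-distribˡ-+ x y d))
                                                  (m%n%n≡m%n z d) ⟩
  ((x + y) % d + z % d) % d                  ≡⟨ sym (%-distribˡ-+ (x + y) z d) ⟩
  (x + y + z) % d                            ∎
  where open ≡-Reasoning

state-B : ∀ n → state n ≡ (B n % 64 , B (1 + n) % 64 , B (2 + n) % 64)
state-B zero    = refl
state-B (suc n) = trans (cong step (state-B n))
  (cong (λ r → B (1 + n) % 64 , B (2 + n) % 64 , r)
    (%-distribˡ-+₃ (B (2 + n)) (B (1 + n)) (B n) 64))

-- Kept general in p: with p = 128 and symbolic q, the type checker would unfold
-- 128 steps from an unknown state.
fold-periodic : ∀ {A : Set} {z : A} {s} p → fold z s p ≡ z → ∀ q → fold z s (q * p) ≡ z
fold-periodic p eq zero    = refl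
fold-periodic {z = z} {s} p eq (suc q) = trans (fold-+ z s p)
  (trans (cong (λ x → fold x s p) (fold-periodic p eq q)) eq)

residue-periodic : ∀ r q → residue (r + q * 128) ≡ residue r
residue-periodic r q = cong proj₁ (trans (fold-+ _ step r)
  -- `fold-+` has split off the `q * 128` steps that are run first. Here `refl` evaluates 128 steps
  -- from `(1 , 0 , 0)` and finds the same triple again.
  (cong (λ s → fold s step r) (fold-periodic 128 refl q)))

residue-% : ∀ n → residue (n % 128) ≡ residue n
residue-% n = sym (trans (cong residue (m≡m%n+[m/n]*n n 128))
                         (residue-periodic (n % 128) (n / 128)))

2^[1+k]∣64 : ∀ {k} → k < 6 → 2 ^ suc k ∣ 64
2^[1+k]∣64 = from-yes (allUpTo? (λ k → 2 ^ suc k ∣? 64) 6)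

2^[1+k]∣32 : ∀ {k} → k < 5 → 2 ^ suc k ∣ 32
2^[1+k]∣32 = from-yes (allUpTo? (λ k → 2 ^ suc k ∣? 32) 5)

-- `B n` differs from its remainder by a multiple of 64, and `2 ^ suc k` divides 64 exactly when
-- `k < 6`.
v₂-residue : ∀ {k} n → k < 6 → k ^∥ residue n → v₂ (B n) ≡ [ k ]
v₂-residue {k} n k<6 k^∥r = ^∥⇒v₂ (subst (k ^∥_) (sym (m≡m%n+[m/n]*n (B n) 64))
  (^∥-+ k (∣-trans (2^[1+k]∣64 k<6) (n∣m*n (B n / 64)))
    (subst (k ^∥_) (cong proj₁ (state-B n)) k^∥r)))

Check : (m c k : ℕ) .{{_ : NonZero m}} → Set
Check m c k = ∀ {r} → r < 128 → r % m ≡ c → k ^∥ residue r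

check? : ∀ m c k .{{_ : NonZero m}} → Dec (Check m c k)
check? m c k = allUpTo? (λ r → (r % m ≟ c) →-dec (k ^∥? residue r)) 128

-- Because `m ∣ 128`, replacing `n` by `n % 128` preserves its class modulo `m` as well as its
-- `residue`, so the finite check applies to it.
v₂-class : ∀ {m c k} .{{_ : NonZero m}} → m ∣ 128 → k < 6 → Check m c k →
           ∀ n → n % m ≡ c → v₂ (B n) ≡ [ k ]
v₂-class {m} {c} {k} m∣128 k<6 check n n%m≡c = v₂-residue n k<6
  (subst (k ^∥_) (residue-% n)
    (check (m%n<n n 128) (trans (m∣n⇒o%n%m≡o%m m 128 n m∣128) n%m≡c)))

-- For `r = 0` and `r = 31` the product is divisible by 32, so the premise fails for every `k < 5`
-- and nothing is claimed.
check-4a+2 : ∀ {r} → r < 32 → ∀ {k} → k < 5 →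
             k ^∥ r * (r + 1) → suc k ^∥ residue (4 * r + 2)
check-4a+2 = from-yes (allUpTo? (λ r → allUpTo? (λ k →
  (k ^∥? r * (r + 1)) →-dec (suc k ^∥? residue (4 * r + 2))) 5) 32)

-- Passing from `a` to `r = a % 32` changes `a * (a + 1)` by a multiple of 32, which preserves exact
-- exponents below 5, and changes the index by a multiple of `4 * 32 = 128`, the period.
residue-4a+2 : ∀ a {k} → k < 5 → k ^∥ a * (a + 1) → suc k ^∥ residue (4 * a + 2)
residue-4a+2 a {k} k<5 k^∥ = subst (suc k ^∥_)
  (sym (trans (cong residue index) (residue-periodic (4 * r + 2) q)))
  (check-4a+2 (m%n<n a 32) k<5
    (^∥-+⁻ k (∣-trans (2^[1+k]∣32 k<5) (n∣m*n (q * (r + r + 1 + q * 32))))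
      (subst (k ^∥_) product k^∥)))
  where
  r = a % 32
  q = a / 32

  index-expand : ∀ r q → 4 * (r + q * 32) + 2 ≡ 4 * r + 2 + q * 128
  index-expand = solve-∀

  product-expand : ∀ r q → (r + q * 32) * (r + q * 32 + 1)
                 ≡ r * (r + 1) + (q * (r + r + 1 + q * 32)) * 32
  product-expand = solve-∀

  index : 4 * a + 2 ≡ 4 * r + 2 + q * 128
  index = trans (cong (λ x → 4 * x + 2) (m≡m%n+[m/n]*n a 32)) (index-expand r q)

  product : a * (a + 1) ≡ r * (r + 1) + (q * (r + r + 1 + q * 32)) * 32
  product = trans (cong (λ x → x * (x + 1)) (m≡m%n+[m/n]*n a 32)) (product-expand r q)

v₂-4a+2 : ∀ a → v₂ (a * (a + 1)) ≤∞ [ 4 ] →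
          v₂ (B (4 * a + 2)) ≡ [ 1 ] +∞ v₂ (a * (a + 1))
v₂-4a+2 a v≤4 with v₂ (a * (a + 1)) in v≡ | v≤4
-- The value `⊤⁺` is excluded by the bound. This disposes of `a = 0`, where the index is 2 and `B 2`
-- is 0.
... | [ k ] | [k]≤[4] = v₂-residue (4 * a + 2) (s≤s (s≤s k≤4))
                        (residue-4a+2 a (s≤s k≤4) (v₂-spec v≡))
  where k≤4 = [≤]-injective [k]≤[4]

theorem10 : (n : ℕ) →
    (n % 4 ≡ 0 → v₂ (B n) ≡ [ 0 ])
    × (n % 8 ≡ 5 → v₂ (B n) ≡ [ 1 ])
    × (n % 16 ≡ 9 → v₂ (B n) ≡ [ 3 ])
    × ((a : ℕ) → n ≡ 4 * a + 2 → v₂ (a * (a + 1)) ≤∞ [ 4 ] →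
    v₂ (B n) ≡ [ 1 ] +∞ v₂ (a * (a + 1)))
    × (n % 4 ≡ 3 → v₂ (B n) ≡ [ 0 ])
theorem10 n =
    v₂-class (from-yes (4 ∣? 128)) (s≤s z≤n) (from-yes (check? 4 0 0)) n
  , v₂-class (from-yes (8 ∣? 128)) (s≤s (s≤s z≤n)) (from-yes (check? 8 5 1)) n
  , v₂-class (from-yes (16 ∣? 128)) (s≤s (s≤s (s≤s (s≤s z≤n)))) (from-yes (check? 16 9 3)) n
  , (λ { a refl → v₂-4a+2 a })
  , v₂-class (from-yes (4 ∣? 128)) (s≤s z≤n) (from-yes (check? 4 3 0)) n
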